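{- Let $\mathcal{I}(n)$ denote the maximum CF-chromatic number $\chi_{\mathrm{cf}}(G)$ over all circle graphs $G$ on at most $n$ vertices. Then $\mathcal{I}(n)=\Theta(\log n)$.
   Context: A circle graph is the intersection graph of a finite family of chords of a circle (vertices are the chords, two adjacent iff the chords intersect); equivalently, the overlap graph of a finite family of intervals on a line (two intervals adjacent iff they intersect but neither contains the other). For a graph $G=(V,E)$ and $v\in V$, the punctured neighborhood is $N_G(v)=\{u\in V:\{u,v\}\in E\}$. A (punctured) conflict-free coloring (CF-coloring) of $G$ is a map $c:V\to\mathbb{N}$ such that for every vertex $v$ with $N_G(v)\neq\emptyset$ there is a color $i$ with $|N_G(v)\cap c^{ -1}(i)|=1$ (vertices with empty neighborhood impose no condition). $\chi_{\mathrm{cf}}(G)$ is the minimum number of colors in a CF-coloring of $G$. -}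

module Defs where

open import Data.Nat using (ℕ; _≤_; _<_)
open import Data.Fin using (Fin)
open import Data.Product using (Σ; ∃; _×_; _,_)
open import Relation.Nullary using (¬_)
open import Relation.Binary.PropositionalEquality using (_≡_)

-- A closed interval [left , right] on the line with integer endpoints,
-- left < right (a chord has two distinct endpoints).  Every finite family
-- of real intervals is order-isomorphic (on endpoints) to one with ℕ endpoints.
record Interval : Set where
  constructor ⟦_,_⟧⟨_⟩
  field
    left  : ℕ
    right : ℕ
    left<right : left < right
open Interval public

Intersect : Interval → Interval → Set
Intersect I J = (left I ≤ right J) × (left J ≤ right I)

Contains : Interval → Interval → Set
Contains I J = (left I ≤ left J) × (right J ≤ right I)

Overlap : Interval → Interval → Set
Overlap I J = Intersect I J × ¬ Contains I J × ¬ Contains J I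

Graph : ℕ → Set₁
Graph n = Fin n → Fin n → Set

-- The circle graph given as the overlap graph of a family of m intervals.
OverlapGraph : ∀ {m} → (Fin m → Interval) → Graph m
OverlapGraph I u v = Overlap (I u) (I v)

IsCFColoring : ∀ {n k} → Graph n → (Fin n → Fin k) → Set
IsCFColoring {n} {k} G c =
  (v : Fin n) → ∃ (λ u → G v u) →
    Σ (Fin k) λ i → Σ (Fin n) λ u →
      G v u × c u ≡ i × ((w : Fin n) → G v w → c w ≡ i → w ≡ u)

CFColorableWith : ∀ {n} → Graph n → ℕ → Set
CFColorableWith {n} G k = Σ (Fin n → Fin k) λ c → IsCFColoring G c

CFChromaticAtLeast : ∀ {n} → Graph n → ℕ → Set
CFChromaticAtLeast G k = ∀ j → CFColorableWith G j → k ≤ j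

{-# OPTIONS --safe #-}
-- Upper bound.  Root each component at a longest interval r and take BFS layers.  The layers
-- before i form a connected set of chords that does not cross a chord v of layer i + 1, so it
-- lies outside v (unless v is a twin of r); every chord of layer i crosses that set and therefore
-- has at most one end inside v.  Hence the neighbors of v in layer i are the chords with an end
-- in a window of the line.  Joining chords with consecutive ends gives a graph of degree ≤ 4, so
-- a fifth of the layer is independent.  Give it one color and recurse on the rest: a window
-- missing the rest contains only independent chords, hence just one.  This takes O(log n)
-- colors, and indices modulo 3 separate a layer from the other layers seen by v.
--
-- Lower bound.  Let the leaves of a complete binary tree be intervals reaching far to the right
-- and let each inner node be an interval overlapping exactly the leaves below it.  The color
-- that is unique below a node is missing from the half not containing its leaf, so the number
-- of colors grows with the height.
module Submission where

open import Defs
open import Data.Bool using (if_then_else_)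
open import Data.Nat using (ℕ; zero; suc; _+_; _*_; _∸_; _^_; _≤_; _<_; z≤n; s≤s; z<s; _<?_; _≤?_; ⌊_/2⌋; ⌈_/2⌉)
open import Data.Nat.Induction using (<-wellFounded)
open import Data.Nat.Logarithm using (⌊log₂_⌋; ⌊log₂⌋-mono-≤; ⌊log₂[2^n]⌋≡n; ⌊log₂⌊n/2⌋⌋≡⌊log₂n⌋∸1)
open import Data.Nat.Properties
open import Data.Fin using (Fin; zero; suc; toℕ; combine; inject≤)
open import Data.Fin.Patterns using (0F; 1F; 2F; 3F)
import Data.Fin.Properties as Fin
open import Data.List using (List; []; _∷_; _++_; length; filter; lookup; allFin)
open import Data.List.Extrema ≤-totalOrder using (argmax; argmax-sel; f[⊥]≤f[argmax]; f[xs]≤f[argmax])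
open import Data.List.Membership.Propositional using (_∈_; _∉_; find; lose)
open import Data.List.Membership.Propositional.Properties using (∈-filter⁺; ∈-filter⁻; ∈-lookup; ∈-allFin; ∈-++⁺ˡ; ∈-++⁺ʳ; ∈-++⁻)
open import Data.List.Properties using (length-++; length-filter; filter-notAll; length-tabulate)
open import Data.List.Relation.Binary.Subset.Propositional using (_⊆_)
open import Data.List.Relation.Unary.All using (All; []; _∷_)
import Data.List.Relation.Unary.All as All
open import Data.List.Relation.Unary.AllPairs using ([]; _∷_)
open import Data.List.Relation.Unary.Any using (here; there; index)
import Data.List.Relation.Unary.Any as Any
import Data.List.Relation.Unary.Any.Properties as Any
open import Data.List.Relation.Unary.Unique.Propositional using (Unique)
import Data.List.Relation.Unary.Unique.Propositional.Properties as Unique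
open import Data.Product using (Σ; ∃; _×_; _,_; proj₁; proj₂)
open import Data.Sum using (_⊎_; inj₁; inj₂; swap)
open import Function using (_∘_)
open import Induction.WellFounded using (Acc; acc)
open import Relation.Binary.Definitions using (tri<; tri≈; tri>)
open import Relation.Binary.PropositionalEquality
open import Relation.Nullary using (¬_; Dec; yes; no; contradiction; ¬?; _×-dec_; _⊎-dec_)
open import Relation.Nullary.Decidable using (does; dec-true; dec-false; from-yes)
open import Relation.Unary using (Decidable)

-- Coloring by windows

length-filter-complement : ∀ {A : Set} {P : A → Set} (P? : Decidable P) xs →
  length xs ≡ length (filter P? xs) + length (filter (¬? ∘ P?) xs)
length-filter-complement P? [] = refl
length-filter-complement P? (x ∷ xs) with P? x
... | yes _ = cong suc (length-filter-complement P? xs)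
... | no _ = trans (cong suc (length-filter-complement P? xs)) (sym (+-suc _ _))

lookup-injective : ∀ {A : Set} {xs : List A} → Unique xs → ∀ i j → lookup xs i ≡ lookup xs j → i ≡ j
lookup-injective (_ ∷ _) zero zero _ = refl
lookup-injective (x∉ ∷ _) zero (suc j) eq = contradiction eq (All.lookup x∉ (∈-lookup j))
lookup-injective (x∉ ∷ _) (suc i) zero eq = contradiction (sym eq) (All.lookup x∉ (∈-lookup i))
lookup-injective (_ ∷ u) (suc i) (suc j) eq = cong suc (lookup-injective u i j eq)

-- Pigeonhole. The labels form a relation, so they have to exist only for members of `xs`.
unique-length≤ : ∀ {A : Set} {n} (R : A → Fin n → Set) {xs : List A} → Unique xs →
  (∀ {x} → x ∈ xs → ∃ (R x)) →
  (∀ {x y k} → x ∈ xs → y ∈ xs → R x k → R y k → x ≡ y) →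
  length xs ≤ n
unique-length≤ {n = n} R {xs} uxs label inj with length xs ≤? n
... | yes p = p
... | no ≰n =
  let f = λ i → label (∈-lookup {xs = xs} i)
      i , j , i<j , fi≡fj = Fin.pigeonhole (≰⇒> ≰n) (proj₁ ∘ f)
      xi≡xj = inj (∈-lookup i) (∈-lookup j) (subst (R _) fi≡fj (proj₂ (f i))) (proj₂ (f j))
  in contradiction (lookup-injective uxs i j xi≡xj) (Fin.<⇒≢ i<j)

⊆-length≤ : ∀ {A : Set} {xs ys : List A} → Unique xs → xs ⊆ ys → length xs ≤ length ys
⊆-length≤ {ys = ys} uxs xs⊆ys =
  unique-length≤ (λ x k → x ≡ lookup ys k) uxs
    (λ x∈ → index (xs⊆ys x∈) , Any.lookup-index (xs⊆ys x∈))
    (λ _ _ p q → trans p (sym q))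

module Windows {m : ℕ} (pos : Fin m → Fin 2 → ℕ)
  (pos-injective : ∀ {u w s t} → pos u s ≡ pos w t → u ≡ w) where

  open import Data.List.Membership.DecPropositional (Fin._≟_ {m}) using (_∈?_)

  private V = Fin m

  module _ (S : List V) where

    Consecutive : ℕ → ℕ → Set
    Consecutive a b = a < b × All (λ z → ∀ s → ¬ (a < pos z s × pos z s < b)) S

    consecutive? : ∀ a b → Dec (Consecutive a b)
    consecutive? a b = a <? b ×-dec
      All.all? (λ z → Fin.all? λ s → ¬? (a <? pos z s ×-dec pos z s <? b)) S

    Follows : V → V → Set
    Follows u w = ∃ λ s → ∃ λ t → Consecutive (pos u s) (pos w t)

    follows? : ∀ u w → Dec (Follows u w)
    follows? u w = Fin.any? λ s → Fin.any? λ t → consecutive? (pos u s) (pos w t)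

    Adjacent : V → V → Set
    Adjacent u w = Follows u w ⊎ Follows w u

    adjacent? : ∀ u w → Dec (Adjacent u w)
    adjacent? u w = follows? u w ⊎-dec follows? w u

    -- If two different ends both came directly after `a`, the smaller would lie in the gap before
    -- the larger.
    next-unique : ∀ {a w x t t′} → w ∈ S → x ∈ S →
      Consecutive a (pos w t) → Consecutive a (pos x t′) → w ≡ x
    next-unique {a} {w} {x} {t} {t′} w∈S x∈S (a<w , gapw) (a<x , gapx)
      with <-cmp (pos w t) (pos x t′)
    ... | tri< lt _ _ = contradiction (a<w , lt) (All.lookup gapx w∈S t)
    ... | tri≈ _ eq _ = pos-injective eq
    ... | tri> _ _ gt = contradiction (a<x , gt) (All.lookup gapw x∈S t′)

    previous-unique : ∀ {b w x t t′} → w ∈ S → x ∈ S →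
      Consecutive (pos w t) b → Consecutive (pos x t′) b → w ≡ x
    previous-unique {b} {w} {x} {t} {t′} w∈S x∈S (w<b , gapw) (x<b , gapx)
      with <-cmp (pos w t) (pos x t′)
    ... | tri< lt _ _ = contradiction (lt , x<b) (All.lookup gapw x∈S t′)
    ... | tri≈ _ eq _ = pos-injective eq
    ... | tri> _ _ gt = contradiction (gt , w<b) (All.lookup gapx w∈S t)

    -- The labels are the successor and the predecessor of each of the two ends of `u`. Each fits at
    -- most one member of `S`, which bounds the degree by 4.
    AdjacentAs : V → V → Fin 4 → Set
    AdjacentAs u w 0F = ∃ λ t → Consecutive (pos u 0F) (pos w t)
    AdjacentAs u w 1F = ∃ λ t → Consecutive (pos u 1F) (pos w t)
    AdjacentAs u w 2F = ∃ λ t → Consecutive (pos w t) (pos u 0F)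
    AdjacentAs u w 3F = ∃ λ t → Consecutive (pos w t) (pos u 1F)

    adjacent-kind : ∀ {u w} → Adjacent u w → ∃ (AdjacentAs u w)
    adjacent-kind (inj₁ (0F , t , c)) = 0F , t , c
    adjacent-kind (inj₁ (1F , t , c)) = 1F , t , c
    adjacent-kind (inj₂ (t , 0F , c)) = 2F , t , c
    adjacent-kind (inj₂ (t , 1F , c)) = 3F , t , c

    adjacentAs-unique : ∀ {u w x} k → w ∈ S → x ∈ S →
      AdjacentAs u w k → AdjacentAs u x k → w ≡ x
    adjacentAs-unique 0F w∈S x∈S (_ , c) (_ , d) = next-unique w∈S x∈S c d
    adjacentAs-unique 1F w∈S x∈S (_ , c) (_ , d) = next-unique w∈S x∈S c d
    adjacentAs-unique 2F w∈S x∈S (_ , c) (_ , d) = previous-unique w∈S x∈S c d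
    adjacentAs-unique 3F w∈S x∈S (_ , c) (_ , d) = previous-unique w∈S x∈S c d

    degree≤4 : ∀ u {xs} → Unique xs → xs ⊆ S → length (filter (adjacent? u) xs) ≤ 4
    degree≤4 u {xs} uxs xs⊆S = unique-length≤ (AdjacentAs u)
      (Unique.filter⁺ (adjacent? u) uxs)
      (λ x∈ → adjacent-kind (proj₂ (∈-filter⁻ (adjacent? u) {xs = xs} x∈)))
      (λ {_} {_} {k} x∈ y∈ → adjacentAs-unique k (inS x∈) (inS y∈))
      where
      inS : ∀ {x} → x ∈ filter (adjacent? u) xs → x ∈ S
      inS x∈ = xs⊆S (proj₁ (∈-filter⁻ (adjacent? u) {xs = xs} x∈))

    Independent : List V → Set
    Independent M = ∀ {u w} → u ∈ M → w ∈ M → u ≢ w → ¬ Follows u w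

    -- Greedy choice: keep `u` and drop its at most four neighbors, so each chosen vertex uses up at
    -- most five. Adjacency refers to the fixed list `S` throughout; `k` bounds the length for the
    -- recursion.
    large-independent : ∀ k xs → length xs ≤ k → Unique xs → xs ⊆ S →
      ∃ λ M → M ⊆ xs × Unique M × Independent M × length xs ≤ 5 * length M
    large-independent k [] _ _ _ = [] , (λ ()) , [] , (λ ()) , z≤n
    large-independent (suc k) (u ∷ xs) (s≤s |xs|≤k) (u∉xs ∷ uxs) xs⊆S =
      let M , M⊆ys , uM , indM , |ys|≤5|M| =
            large-independent k ys (≤-trans |ys|≤|xs| |xs|≤k) (Unique.filter⁺ (¬? ∘ adjacent? u) uxs)
              (xs⊆S ∘ there ∘ ys⊆xs)
      in u ∷ M
       , (λ { (here p) → here p ; (there x∈M) → there (ys⊆xs (M⊆ys x∈M)) })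
       , All.tabulate (λ x∈M → All.lookup u∉xs (ys⊆xs (M⊆ys x∈M))) ∷ uM
       , (λ { (here refl) (here refl) u≢u _ → u≢u refl
            ; (here refl) (there w∈M) _ f → non-adjacent (M⊆ys w∈M) (inj₁ f)
            ; (there w∈M) (here refl) _ f → non-adjacent (M⊆ys w∈M) (inj₂ f)
            ; (there x∈M) (there w∈M) → indM x∈M w∈M })
       , (begin
           suc (length xs)                   ≡⟨ cong suc (length-filter-complement (adjacent? u) xs) ⟩
           suc (length (filter (adjacent? u) xs) + length ys)
                                             ≤⟨ s≤s (+-mono-≤ (degree≤4 u uxs (xs⊆S ∘ there)) |ys|≤5|M|) ⟩
           5 + 5 * length M                  ≡⟨ *-suc 5 (length M) ⟨
           5 * suc (length M)                ∎)
      where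
      open ≤-Reasoning
      ys = filter (¬? ∘ adjacent? u) xs
      ys⊆xs : ys ⊆ xs
      ys⊆xs x∈ = proj₁ (∈-filter⁻ (¬? ∘ adjacent? u) {xs = xs} x∈)
      non-adjacent : ∀ {w} → w ∈ ys → ¬ Adjacent u w
      non-adjacent x∈ = proj₂ (∈-filter⁻ (¬? ∘ adjacent? u) {xs = xs} x∈)
      |ys|≤|xs| : length ys ≤ length xs
      |ys|≤|xs| = ≤-trans (m≤n+m _ _) (≤-reflexive (sym (length-filter-complement (adjacent? u) xs)))

    -- Descent: an end of `S` strictly between `a` and the current candidate replaces the candidate,
    -- and positions are well-founded.
    next : ∀ {a w} t → w ∈ S → a < pos w t →
      ∃ λ z → z ∈ S × ∃ λ s → Consecutive a (pos z s) × pos z s ≤ pos w t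
    next {a} t w∈S a<w = go t w∈S a<w (<-wellFounded _)
      where
      go : ∀ {w} t → w ∈ S → a < pos w t → Acc _<_ (pos w t) →
        ∃ λ z → z ∈ S × ∃ λ s → Consecutive a (pos z s) × pos z s ≤ pos w t
      go {w} t w∈S a<w (acc rec)
        with Any.any? (λ z → Fin.any? λ s → a <? pos z s ×-dec pos z s <? pos w t) S
      ... | no none = w , w∈S , t ,
              (a<w , All.tabulate (λ z∈S s between → none (lose z∈S (s , between)))) , ≤-refl
      ... | yes some =
              let _ , z∈S , s , a<z , z<w = find some
                  y , y∈S , r , c , y≤z = go s z∈S a<z (rec z<w)
              in y , y∈S , r , c , ≤-trans y≤z (<⇒≤ z<w)

  InWindow : ℕ → ℕ → ℕ → Set
  InWindow lo hi x = lo ≤ x × x < hi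

  -- Only windows with at most one end of each member count, because `Independent` still allows two
  -- consecutive ends of the same vertex.
  ConflictFree : ∀ {k} → List V → (V → Fin k) → Set
  ConflictFree S φ = ∀ lo hi →
    (∀ {u} → u ∈ S → ∀ s t → InWindow lo hi (pos u s) → InWindow lo hi (pos u t) → s ≡ t) →
    ∀ {u} s → u ∈ S → InWindow lo hi (pos u s) →
    ∃ λ w → w ∈ S × (∃ λ t → InWindow lo hi (pos w t)) ×
      (∀ {x} t → x ∈ S → InWindow lo hi (pos x t) → φ x ≡ φ w → x ≡ w)

  -- Each round spends one color on an independent fifth and leaves at most four fifths, so the
  -- bound survives with `t` lowered by one. At `t = 0` it forces `S` to be empty.
  conflict-free-coloring : ∀ t S → Unique S → 4 ^ t * length S < 5 ^ t →
    Σ (V → Fin (suc t)) (ConflictFree S)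
  conflict-free-coloring zero [] _ _ = (λ _ → zero) , λ _ _ _ _ ()
  conflict-free-coloring zero (_ ∷ _) _ (s≤s ())
  conflict-free-coloring (suc t) S uS small = φ , cf
    where
    indep = large-independent S (length S) S ≤-refl uS (λ x∈ → x∈)
    M = proj₁ indep
    M⊆S : M ⊆ S
    M⊆S = proj₁ (proj₂ indep)
    uM = proj₁ (proj₂ (proj₂ indep))
    indM = proj₁ (proj₂ (proj₂ (proj₂ indep)))
    |S|≤5|M| = proj₂ (proj₂ (proj₂ (proj₂ indep)))

    inM? : Decidable (_∈ M)
    inM? u = u ∈? M

    rest = filter (¬? ∘ inM?) S

    shrink : 5 * length rest ≤ 4 * length S
    -- Adding `length S` to both sides makes the right one `5 * length S`; on the left it is at most
    -- `5 * length M`.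
    shrink = +-cancelˡ-≤ (length S) _ _ (begin
      length S + 5 * length rest                     ≤⟨ +-monoˡ-≤ _ |S|≤5|M| ⟩
      5 * length M + 5 * length rest                 ≡⟨ *-distribˡ-+ 5 (length M) (length rest) ⟨
      5 * (length M + length rest)                   ≤⟨ *-monoʳ-≤ 5 (+-monoˡ-≤ _ |M|≤) ⟩
      5 * (length (filter inM? S) + length rest)     ≡⟨ cong (5 *_) (length-filter-complement inM? S) ⟨
      5 * length S                                   ∎)
      where
      open ≤-Reasoning
      |M|≤ : length M ≤ length (filter inM? S)
      |M|≤ = ⊆-length≤ uM (λ x∈M → ∈-filter⁺ inM? (M⊆S x∈M) x∈M)

    rest-small : 4 ^ t * length rest < 5 ^ t
    rest-small = *-cancelˡ-< 5 _ _ (begin-strict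
      5 * (4 ^ t * length rest)   ≡⟨ *-assoc 5 (4 ^ t) _ ⟨
      5 * 4 ^ t * length rest     ≡⟨ cong (_* length rest) (*-comm 5 (4 ^ t)) ⟩
      4 ^ t * 5 * length rest     ≡⟨ *-assoc (4 ^ t) 5 _ ⟩
      4 ^ t * (5 * length rest)   ≤⟨ *-monoʳ-≤ (4 ^ t) shrink ⟩
      4 ^ t * (4 * length S)      ≡⟨ *-assoc (4 ^ t) 4 _ ⟨
      4 ^ t * 4 * length S        ≡⟨ cong (_* length S) (*-comm (4 ^ t) 4) ⟩
      4 ^ suc t * length S        <⟨ small ⟩
      5 * 5 ^ t                   ∎)
      where open ≤-Reasoning

    IH = conflict-free-coloring t rest (Unique.filter⁺ (¬? ∘ inM?) uS) rest-small
    φ′ = proj₁ IH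

    φ : V → Fin (suc (suc t))
    φ u with inM? u
    ... | yes _ = zero
    ... | no _ = suc (φ′ u)

    φ-rest : ∀ {u} → u ∉ M → φ u ≡ suc (φ′ u)
    φ-rest {u} u∉M with inM? u
    ... | yes u∈M = contradiction u∈M u∉M
    ... | no _ = refl

    same-as-rest : ∀ {x k} → φ x ≡ suc k → x ∉ M × φ′ x ≡ k
    same-as-rest {x} eq with inM? x
    same-as-rest {x} () | yes _
    ... | no x∉M = x∉M , Fin.suc-injective eq

    cf : ConflictFree S φ
    cf lo hi once {u} s u∈S u-in
      with Any.any? (λ w → Fin.any? λ t → lo ≤? pos w t ×-dec pos w t <? hi) rest
    -- The recursive witness stays unique: members of `M` have color zero and all other colors are
    -- shifted by `suc`.
    ... | yes some =
          let _ , x∈rest , r , x-in = find some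
              w , w∈rest , w-in , unique =
                proj₂ IH lo hi (λ y∈ → once (proj₁ (split y∈))) r x∈rest x-in
              w∈S , w∉M = split w∈rest
          in w , w∈S , w-in , λ r x∈S x-in eq →
               let x∉M , eq′ = same-as-rest (trans eq (φ-rest w∉M))
               in unique r (∈-filter⁺ (¬? ∘ inM?) x∈S x∉M) x-in eq′
      where
      split : ∀ {y} → y ∈ rest → y ∈ S × y ∉ M
      split = ∈-filter⁻ (¬? ∘ inM?) {xs = S}
    ... | no none = u , u∈S , (s , u-in) , λ r x∈S x-in _ → alone r x∈S x-in
      where
      hits-M : ∀ {x} r → x ∈ S → InWindow lo hi (pos x r) → x ∈ M
      hits-M {x} r x∈S x-in with inM? x
      ... | yes x∈M = x∈M
      ... | no x∉M = contradiction (lose (∈-filter⁺ (¬? ∘ inM?) x∈S x∉M) (r , x-in)) none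

      -- The end directly after `pos y q` is still in the window. Its vertex lies in `M` and differs
      -- from `y`, so it would be a neighbor of `y` inside the independent set.
      not-before : ∀ {y x} q r → y ∈ S → x ∈ S → InWindow lo hi (pos y q) →
        InWindow lo hi (pos x r) → ¬ pos y q < pos x r
      not-before q r y∈S x∈S y-in x-in y<x
        with z , z∈S , p , c@(y<z , _) , z≤x ← next S r x∈S y<x =
        let z-in = ≤-trans (proj₁ y-in) (<⇒≤ y<z) , ≤-<-trans z≤x (proj₂ x-in)
            y≢z = λ { refl → <-irrefl (cong (pos z) (once z∈S q p y-in z-in)) y<z }
        in indM (hits-M q y∈S y-in) (hits-M p z∈S z-in) y≢z (q , p , c)

      alone : ∀ {x} r → x ∈ S → InWindow lo hi (pos x r) → x ≡ u
      alone {x} r x∈S x-in with <-cmp (pos x r) (pos u s)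
      ... | tri< lt _ _ = contradiction lt (not-before r s x∈S u∈S x-in u-in)
      ... | tri≈ _ eq _ = pos-injective eq
      ... | tri> _ _ gt = contradiction gt (not-before s r u∈S x∈S u-in x-in)

-- Layers of a chord diagram

rotate : Fin 3 → Fin 3
rotate 0F = 1F
rotate 1F = 2F
rotate 2F = 0F

mod3 : ℕ → Fin 3
mod3 zero = 0F
mod3 (suc n) = rotate (mod3 n)

-- The neighbors of a chord of level `i + 1` have levels `i` to `i + 2`; among these the residue
-- singles out level `i`.
mod3-separates : ∀ {i j} → i ≤ j → j ≤ 2 + i → mod3 j ≡ mod3 i → j ≡ i
mod3-separates {i} {j} i≤j j≤2+i eq with m≤n⇒m<n∨m≡n i≤j
... | inj₂ i≡j = sym i≡j
... | inj₁ i<j with m≤n⇒m<n∨m≡n i<j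
...   | inj₂ refl = contradiction eq (rotate≢ (mod3 i))
  where
  rotate≢ : ∀ x → rotate x ≢ x
  rotate≢ 0F ()
  rotate≢ 1F ()
  rotate≢ 2F ()
...   | inj₁ 1+i<j with refl ← ≤-antisym 1+i<j j≤2+i = contradiction eq (rotate²≢ (mod3 i))
  where
  rotate²≢ : ∀ x → rotate (rotate x) ≢ x
  rotate²≢ 0F ()
  rotate²≢ 1F ()
  rotate²≢ 2F ()

module Chords {m : ℕ} (a b : Fin m → ℕ) (a<b : ∀ u → a u < b u) where

  private V = Fin m

  CrossLeft : V → V → Set
  CrossLeft u v = a u < a v × a v < b u × b u < b v

  Cross : V → V → Set
  Cross u v = CrossLeft u v ⊎ CrossLeft v u

  cross-sym : ∀ {u v} → Cross u v → Cross v u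
  cross-sym = swap

  cross-twin : ∀ {u v w} → a u ≡ a v → b u ≡ b v → Cross u w → Cross v w
  cross-twin {w = w} = subst₂ λ x y →
    (x < a w × a w < y × y < b w) ⊎ (a w < x × x < b w × b w < y)

  crossLeft? : ∀ u v → Dec (CrossLeft u v)
  crossLeft? u v = a u <? a v ×-dec a v <? b u ×-dec b u <? b v

  cross? : ∀ u v → Dec (Cross u v)
  cross? u v = crossLeft? u v ⊎-dec crossLeft? v u

  Contained : V → V → Set
  Contained u v = a v ≤ a u × b u ≤ b v

  contained? : ∀ u v → Dec (Contained u v)
  contained? u v = a v ≤? a u ×-dec b u ≤? b v

  end : V → Fin 2 → ℕ
  end u 0F = a u
  end u 1F = b u

  EndInside : V → Fin 2 → V → Set
  EndInside u s v = a v < end u s × end u s < b v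

  cross⇒endInside : ∀ {u v} → Cross u v → ∃ λ s → EndInside u s v
  cross⇒endInside (inj₁ (au<av , av<bu , bu<bv)) = 1F , av<bu , bu<bv
  cross⇒endInside (inj₂ (av<au , au<bv , bv<bu)) = 0F , av<au , au<bv

  cross⇒¬contained : ∀ {u v} → Cross u v → ¬ Contained u v
  cross⇒¬contained (inj₁ (au<av , _)) (av≤au , _) = <⇒≱ au<av av≤au
  cross⇒¬contained (inj₂ (_ , _ , bv<bu)) (_ , bu≤bv) = <⇒≱ bv<bu bu≤bv

  -- `Contained` is not strict, so its failure puts the other end of `u` strictly beyond `v`.
  endInside⇒cross : ∀ {u v} s → ¬ Contained u v → EndInside u s v → Cross u v
  endInside⇒cross {u} {v} 0F ¬con (av<au , au<bv) with b u ≤? b v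
  ... | yes bu≤bv = contradiction (<⇒≤ av<au , bu≤bv) ¬con
  ... | no bu≰bv = inj₂ (av<au , au<bv , ≰⇒> bu≰bv)
  endInside⇒cross {u} {v} 1F ¬con (av<bu , bu<bv) with a v ≤? a u
  ... | yes av≤au = contradiction (av≤au , <⇒≤ bu<bv) ¬con
  ... | no av≰au = inj₁ (≰⇒> av≰au , av<bu , bu<bv)

  endInside-unique : ∀ {u v} s t → ¬ Contained u v → EndInside u s v → EndInside u t v → s ≡ t
  endInside-unique 0F 0F _ _ _ = refl
  endInside-unique 0F 1F ¬con (p , _) (_ , q) = contradiction (<⇒≤ p , <⇒≤ q) ¬con
  endInside-unique 1F 0F ¬con (_ , q) (p , _) = contradiction (<⇒≤ p , <⇒≤ q) ¬con
  endInside-unique 1F 1F _ _ _ = refl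

  -- A connected set of chords not crossing v lies on one side of v.
  ¬contained-step : ∀ {k u v} → ¬ Contained k v → ¬ Cross k v → Cross k u → ¬ Contained u v
  ¬contained-step ¬con ¬cr cr (av≤au , bu≤bv) =
    let s , au<e , e<bu = cross⇒endInside cr
    in ¬cr (endInside⇒cross s ¬con (≤-<-trans av≤au au<e , <-≤-trans e<bu bu≤bv))

  -- Ends ordered by coordinate, with ties broken by the index of the chord.
  position : V → Fin 2 → ℕ
  position u s = toℕ u + end u s * m

  position< : ∀ u s {y} → end u s < y → position u s < y * m
  position< u s e<y = <-≤-trans (+-monoˡ-< _ (Fin.toℕ<n u)) (*-monoˡ-≤ m e<y)

  position-injective : ∀ {u w s t} → position u s ≡ position w t → u ≡ w
  position-injective {u} {w} {s} {t} eq with <-cmp (end u s) (end w t)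
  ... | tri< lt _ _ = contradiction (<-≤-trans (position< u s lt) (m≤n+m _ (toℕ w))) (<-irrefl eq)
  ... | tri> _ _ gt = contradiction (<-≤-trans (position< w t gt) (m≤n+m _ (toℕ u))) (<-irrefl (sym eq))
  ... | tri≈ _ e≡ _ = Fin.toℕ-injective
    (+-cancelʳ-≡ (end u s * m) _ _ (trans eq (cong (λ e → toℕ w + e * m) (sym e≡))))

  open Windows position (λ {u} {w} {s} {t} → position-injective {u} {w} {s} {t})

  -- Ends with coordinate `e` have positions in `[e * m, (e + 1) * m)`, so this window holds exactly
  -- the ends strictly inside `v`.
  inWindow⁺ : ∀ u s {v} → EndInside u s v → InWindow (suc (a v) * m) (b v * m) (position u s)
  inWindow⁺ u s (av<e , e<bv) = ≤-trans (*-monoˡ-≤ m av<e) (m≤n+m _ (toℕ u)) , position< u s e<bv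

  inWindow⁻ : ∀ u s {v} → InWindow (suc (a v) * m) (b v * m) (position u s) → EndInside u s v
  inWindow⁻ u s (lo≤ , <hi) =
    ≰⇒> (λ e≤av → <⇒≱ (position< u s (s≤s e≤av)) lo≤) ,
    ≰⇒> (λ bv≤e → <⇒≱ <hi (≤-trans (*-monoˡ-≤ m bv≤e) (m≤n+m _ (toℕ u))))

  -- When `v` contains no member of `S`, its neighbors in `S` are the members with an end inside
  -- `v`, and each has only one such end. So the window of `v` is admissible.
  conflict-free-layer : ∀ {k S} {φ : V → Fin k} → ConflictFree S φ → ∀ {v} →
    (∀ {u} → u ∈ S → ¬ Contained u v) → ∀ {u} → u ∈ S → Cross v u →
    ∃ λ w → w ∈ S × Cross v w × (∀ {x} → x ∈ S → Cross v x → φ x ≡ φ w → x ≡ w)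
  conflict-free-layer cf {v} ¬con {u} u∈S v×u =
    let s , inside = cross⇒endInside (cross-sym v×u)
        w , w∈S , (t , w-in) , unique =
          cf (suc (a v) * m) (b v * m)
             (λ {x} x∈S s t p q → endInside-unique s t (¬con x∈S) (inWindow⁻ x s p) (inWindow⁻ x t q))
             s u∈S (inWindow⁺ u s inside)
    in w , w∈S , cross-sym (endInside⇒cross t (¬con w∈S) (inWindow⁻ w t w-in)) ,
       λ {x} x∈S v×x eq → let r , x-inside = cross⇒endInside (cross-sym v×x)
                      in unique r x∈S (inWindow⁺ x r x-inside) eq

  Served : ∀ {k} → (V → Fin k) → V → Set
  Served c v = ∃ (Cross v) → ∃ λ w → Cross v w × (∀ {x} → Cross v x → c x ≡ c w → x ≡ w)

  module _ {P : V → Set} (P? : Decidable P) (P-closed : ∀ {u v} → P u → Cross u v → P v)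
           {k : ℕ} (c d : V → Fin k) where

    -- `P` is a union of components: all neighbors of a chord take their colors from the same one of
    -- `c` and `d`, so both may use the same palette.
    glue : V → Fin k
    glue v = if does (P? v) then c v else d v

    glue-inside : ∀ {v} → P v → glue v ≡ c v
    glue-inside {v} p = cong (if_then c v else d v) (dec-true (P? v) p)

    glue-outside : ∀ {v} → ¬ P v → glue v ≡ d v
    glue-outside {v} ¬p = cong (if_then c v else d v) (dec-false (P? v) ¬p)

    served-inside : ∀ {v} → P v → Served c v → Served glue v
    served-inside p c-served nbr =
      let w , v×w , unique = c-served nbr
          inside = λ {x} v×x → glue-inside {x} (P-closed p v×x)
      in w , v×w , λ v×x eq → unique v×x (trans (sym (inside v×x)) (trans eq (inside v×w)))

    served-outside : ∀ {v} → ¬ P v → Served d v → Served glue v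
    served-outside ¬p d-served nbr =
      let w , v×w , unique = d-served nbr
          outside = λ {x} v×x → glue-outside {x} (λ px → ¬p (P-closed px (cross-sym v×x)))
      in w , v×w , λ v×x eq → unique v×x (trans (sym (outside v×x)) (trans eq (outside v×w)))

  module Component (r : V) where

    -- The ball of radius `k` around `r` in the crossing graph; `AtLevel` is the corresponding
    -- sphere.
    Within : ℕ → V → Set
    Within zero v = v ≡ r
    Within (suc k) v = Within k v ⊎ ∃ λ w → Within k w × Cross w v

    within? : ∀ k → Decidable (Within k)
    within? zero v = v Fin.≟ r
    within? (suc k) v = within? k v ⊎-dec Fin.any? λ w → within? k w ×-dec cross? w v

    within-mono : ∀ {i j v} → i ≤ j → Within i v → Within j v
    within-mono {zero} {zero} _ p = p
    within-mono {zero} {suc j} _ p = inj₁ (within-mono {zero} {j} z≤n p)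
    within-mono {suc i} (s≤s i≤j) (inj₁ p) = inj₁ (within-mono i≤j p)
    within-mono {suc i} (s≤s i≤j) (inj₂ (w , p , cr)) = inj₂ (w , within-mono i≤j p , cr)

    AtLevel : ℕ → V → Set
    AtLevel zero v = v ≡ r
    AtLevel (suc j) v = Within (suc j) v × ¬ Within j v

    atLevel? : ∀ j → Decidable (AtLevel j)
    atLevel? zero v = v Fin.≟ r
    atLevel? (suc j) v = within? (suc j) v ×-dec ¬? (within? j v)

    atLevel⇒within : ∀ j {v} → AtLevel j v → Within j v
    atLevel⇒within zero p = p
    atLevel⇒within (suc j) (p , _) = p

    within⇒atLevel : ∀ k {v} → Within k v → ∃ λ j → AtLevel j v
    within⇒atLevel zero p = zero , p
    within⇒atLevel (suc k) {v} p with within? k v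
    ... | yes q = within⇒atLevel k q
    ... | no ¬q = suc k , p , ¬q

    atLevel-least : ∀ j {i v} → AtLevel j v → Within i v → j ≤ i
    atLevel-least zero _ _ = z≤n
    atLevel-least (suc j) {i} (_ , ¬q) p = ≰⇒> (λ i≤j → ¬q (within-mono i≤j p))

    atLevel-unique : ∀ {i j v} → AtLevel i v → AtLevel j v → i ≡ j
    atLevel-unique {i} {j} p q =
      ≤-antisym (atLevel-least i p (atLevel⇒within j q)) (atLevel-least j q (atLevel⇒within i p))

    atLevel-neighbor : ∀ {i j u v} → AtLevel i u → AtLevel j v → Cross u v → j ≤ suc i
    atLevel-neighbor {i} {j} p q cr = atLevel-least j q (inj₂ (_ , atLevel⇒within i p , cr))

    -- The predecessor `w` has some level `i ≤ j`; were `i` smaller, `v` would have a level below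
    -- `j + 1`.
    parent : ∀ {j v} → AtLevel (suc j) v → ∃ λ w → AtLevel j w × Cross w v
    parent {j} (inj₁ p , ¬p) = contradiction p ¬p
    parent {j} {v} lv@(inj₂ (w , p , cr) , ¬p) =
      let i , lw = within⇒atLevel j p
          i≡j = ≤-antisym (atLevel-least i lw p) (≤-pred (atLevel-neighbor lw lv cr))
      in w , subst (λ i → AtLevel i w) i≡j lw , cr

    levels-inhabited : ∀ {i} j {v} → AtLevel j v → i ≤ j → ∃ (AtLevel i)
    levels-inhabited j lv i≤j with m≤n⇒m<n∨m≡n i≤j
    ... | inj₂ refl = _ , lv
    levels-inhabited (suc j) lv i≤j | inj₁ (s≤s i≤j′) = levels-inhabited j (proj₁ (proj₂ (parent lv))) i≤j′

    -- All levels up to that of `v` are inhabited and disjoint. A level beyond `m` would thus need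
    -- more than `m` chords, so `m` steps exhaust the component.
    within-bounded : ∀ k {v} → Within k v → Within m v
    within-bounded k p with within⇒atLevel k p
    ... | j , lv with j ≤? m
    ...   | yes j≤m = within-mono j≤m (atLevel⇒within j lv)
    ...   | no j≰m =
      let vertex : ∀ (i : Fin (suc m)) → ∃ (AtLevel (toℕ i))
          vertex i = levels-inhabited j lv (<⇒≤ (<-≤-trans (Fin.toℕ<n i) (≰⇒> j≰m)))
          i , i′ , i<i′ , eq = Fin.pigeonhole (n<1+n m) (proj₁ ∘ vertex)
      in contradiction
           (atLevel-unique (proj₂ (vertex i)) (subst (AtLevel (toℕ i′)) (sym eq) (proj₂ (vertex i′))))
           (<⇒≢ i<i′)

    Reached : V → Set
    Reached = Within m

    reached-closed : ∀ {u v} → Reached u → Cross u v → Reached v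
    reached-closed p cr = within-bounded (suc m) (inj₂ (_ , p , cr))

    level : V → ℕ
    level v with within? m v
    ... | yes p = proj₁ (within⇒atLevel m p)
    -- A default for chords outside the component, which are colored separately.
    ... | no _ = zero

    atLevel-level : ∀ {v} → Reached v → AtLevel (level v) v
    atLevel-level {v} p with within? m v
    ... | yes q = proj₂ (within⇒atLevel m q)
    ... | no ¬q = contradiction p ¬q

    level-≡ : ∀ {i v} → AtLevel i v → level v ≡ i
    level-≡ {i} p = atLevel-unique (atLevel-level (within-bounded i (atLevel⇒within i p))) p

    -- Induction along parents from `r`: the parent has level below `i`, so it cannot cross `v`, and
    -- `¬contained-step` passes the property on to the child.
    earlier-layers-¬contained : ∀ {i v} → AtLevel (suc i) v → ¬ Contained r v →
      ∀ {j w} → j ≤ i → AtLevel j w → ¬ Contained w v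
    earlier-layers-¬contained lv r-out {zero} _ refl = r-out
    earlier-layers-¬contained lv r-out {suc j} j<i lw =
      let k , lk , k×w = parent lw
      in ¬contained-step (earlier-layers-¬contained lv r-out (<⇒≤ j<i) lk)
           (λ k×v → <⇒≱ j<i (≤-pred (atLevel-neighbor lk lv k×v))) k×w

    module _ (t : ℕ) (enough : 4 ^ t * m < 5 ^ t) where

      layer : ℕ → List V
      layer i = filter (atLevel? i) (allFin m)

      layer⁺ : ∀ {i u} → AtLevel i u → u ∈ layer i
      layer⁺ {i} {u} = ∈-filter⁺ (atLevel? i) (∈-allFin u)

      layer⁻ : ∀ {i u} → u ∈ layer i → AtLevel i u
      layer⁻ {i} u∈ = proj₂ (∈-filter⁻ (atLevel? i) {xs = allFin m} u∈)

      layer-coloring : ∀ i → Σ (V → Fin (suc t)) (ConflictFree (layer i))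
      layer-coloring i = conflict-free-coloring t (layer i)
        (Unique.filter⁺ (atLevel? i) (Unique.allFin⁺ m))
        (≤-<-trans (*-monoʳ-≤ (4 ^ t) (≤-trans (length-filter (atLevel? i) (allFin m))
                                               (≤-reflexive (length-tabulate {n = m} (λ i → i))))) enough)

      φ : ℕ → V → Fin (suc t)
      φ i = proj₁ (layer-coloring i)

      color : V → Fin (3 * suc t)
      color v = combine (mod3 (level v)) (φ (level v) v)

      -- A neighbor of the same color as the witness shares its residue, hence lies in layer `i`,
      -- where the coloring of that layer decides.
      served-by-layer : ∀ i {v} → (∃ λ u → AtLevel i u × Cross v u) →
        (∀ {u} → AtLevel i u → ¬ Contained u v) →
        (∀ {w} → Cross v w → mod3 (level w) ≡ mod3 i → AtLevel i w) →
        Served color v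
      served-by-layer i {v} (u , lu , v×u) ¬con separated _ =
        let w , w∈ , v×w , unique =
              conflict-free-layer (proj₂ (layer-coloring i)) (λ x∈ → ¬con (layer⁻ x∈)) (layer⁺ lu) v×u
            lev-w = level-≡ (layer⁻ w∈)
        in w , v×w , λ {x} v×x eq →
          let mod3≡ , φ≡ = Fin.combine-injective (mod3 (level x)) _ (mod3 (level w)) _ eq
              lx = separated v×x (trans mod3≡ (cong mod3 lev-w))
          in unique (layer⁺ lx) v×x
               (trans (cong (λ i → φ i x) (sym (level-≡ lx))) (trans φ≡ (cong (λ i → φ i w) lev-w)))

      -- A twin of the root has the same neighbors as the root, all of which form layer 1.
      served-root-twin : ∀ {v} → a v ≡ a r → b v ≡ b r → Served color v
      served-root-twin {v} av≡ar bv≡br (u , v×u) =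
        served-by-layer 1 (u , neighbor v×u , v×u)
          (λ lu → let _ , lw , w×u = parent lu
                  in cross⇒¬contained (cross-sym (cross-twin (sym av≡ar) (sym bv≡br) (subst (λ w → Cross w _) lw w×u))))
          (λ v×w _ → neighbor v×w) (u , v×u)
        where
        neighbor : ∀ {w} → Cross v w → AtLevel 1 w
        neighbor {w} v×w =
          inj₂ (r , refl , cross-twin av≡ar bv≡br v×w) ,
          λ { refl → cross⇒¬contained (cross-twin av≡ar bv≡br v×w) (≤-refl , ≤-refl) }

      -- The layer just before `v` serves it: it holds the parent of `v`, and none of its chords is
      -- contained in `v`.
      served-outside-root : ∀ {v} → Reached v → ¬ Contained r v → Served color v
      served-outside-root {v} reached r-out with level v | atLevel-level reached
      ... | zero | refl = contradiction (≤-refl , ≤-refl) r-out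
      ... | suc i | lv =
        let u , lu , u×v = parent lv
        in served-by-layer i (u , lu , cross-sym u×v)
             (earlier-layers-¬contained lv r-out ≤-refl)
             (λ {w} v×w eq →
               let lw = atLevel-level (reached-closed reached v×w)
                   i≤ = ≤-pred (atLevel-neighbor lw lv (cross-sym v×w))
                   lw≡i = mod3-separates i≤ (atLevel-neighbor lv lw v×w) eq
               in subst (λ j → AtLevel j w) lw≡i lw)

      -- A chord containing the longest chord `r` must be its twin; any other chord falls under the
      -- layer argument.
      served : ∀ {v} → Reached v → b v ∸ a v ≤ b r ∸ a r → Served color v
      served {v} reached longest with contained? r v
      ... | no r-out = served-outside-root reached r-out
      ... | yes (av≤ar , br≤bv) with m≤n⇒m<n∨m≡n av≤ar | m≤n⇒m<n∨m≡n br≤bv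
      ...   | inj₂ av≡ar | inj₂ br≡bv = served-root-twin av≡ar (sym br≡bv)
      ...   | inj₁ av<ar | _ = contradiction longest
        (<⇒≱ (<-≤-trans (∸-monoʳ-< av<ar (<⇒≤ (a<b r))) (∸-monoˡ-≤ (a v) br≤bv)))
      ...   | inj₂ _ | inj₁ br<bv = contradiction longest
        (<⇒≱ (<-≤-trans (∸-monoˡ-< br<bv (<⇒≤ (a<b r))) (∸-monoʳ-≤ (b v) av≤ar)))

  -- Coloring one component after another

  longest : ∀ u us → ∃ λ r → r ∈ u ∷ us × (∀ {v} → v ∈ u ∷ us → b v ∸ a v ≤ b r ∸ a r)
  longest u us = r , r∈ ,
    λ { (here refl) → f[⊥]≤f[argmax] {f = len} u us
      ; (there v∈) → All.lookup (f[xs]≤f[argmax] {f = len} u us) v∈ }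
    where
    len : V → ℕ
    len v = b v ∸ a v
    r = argmax len u us
    r∈ : r ∈ u ∷ us
    r∈ with argmax-sel len u us
    ... | inj₁ eq = here eq
    ... | inj₂ r∈us = there r∈us

  module _ (t : ℕ) (enough : 4 ^ t * m < 5 ^ t) where

    -- Peel off the component of a longest chord of `U`. The rest is again closed under crossing and
    -- lacks that chord, so the bound `k` on the length drops.
    color-closed : ∀ k (U : List V) → length U ≤ k → (∀ {u v} → u ∈ U → Cross u v → v ∈ U) →
      Σ (V → Fin (3 * suc t)) λ c → ∀ {v} → v ∈ U → Served c v
    color-closed k [] _ _ = (λ _ → zero) , λ ()
    color-closed (suc k) U@(u ∷ us) |U|≤ closed =
      glue (within? m) reached-closed c₁ c₂ , served-on-U
      where
      root = longest u us
      open Component (proj₁ root)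
      U′ = filter (¬? ∘ within? m) U
      U′⁻ : ∀ {v} → v ∈ U′ → v ∈ U × ¬ Reached v
      U′⁻ = ∈-filter⁻ (¬? ∘ within? m) {xs = U}
      |U′|≤k : length U′ ≤ k
      |U′|≤k = ≤-pred (≤-trans (filter-notAll (¬? ∘ within? m) U
        (lose (proj₁ (proj₂ root)) (λ ¬p → ¬p (within-mono {0} {m} z≤n refl)))) |U|≤)
      IH = color-closed k U′ |U′|≤k λ x∈ x×y →
        ∈-filter⁺ (¬? ∘ within? m) (closed (proj₁ (U′⁻ x∈)) x×y)
          (λ y-reached → proj₂ (U′⁻ x∈) (reached-closed y-reached (cross-sym x×y)))
      c₁ = color t enough
      c₂ = proj₁ IH
      served-on-U : ∀ {v} → v ∈ U → Served (glue (within? m) reached-closed c₁ c₂) v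
      served-on-U {v} v∈U with within? m v
      ... | yes p = served-inside (within? m) reached-closed c₁ c₂ p
                      (served t enough p (proj₂ (proj₂ root) v∈U))
      ... | no ¬p = served-outside (within? m) reached-closed c₁ c₂ ¬p
                      (proj₂ IH (∈-filter⁺ (¬? ∘ within? m) v∈U ¬p))

    conflict-free : Σ (V → Fin (3 * suc t)) λ c → ∀ v → Served c v
    conflict-free =
      let c , c-served = color-closed _ (allFin m) ≤-refl (λ {_} {v} _ _ → ∈-allFin v)
      in c , λ v → c-served (∈-allFin v)

-- From overlapping intervals to crossing chords

module IntervalChords {m : ℕ} (I : Fin m → Interval) where

  -- Doubling makes left and right ends distinct, so that touching intervals cross strictly.
  a b : Fin m → ℕ
  a u = 2 * left (I u)
  b u = suc (2 * right (I u))

  a<b : ∀ u → a u < b u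
  a<b u = s≤s (*-monoʳ-≤ 2 (<⇒≤ (left<right (I u))))

  open Chords a b a<b

  crossLeft⇒intersect : ∀ {u v} → CrossLeft u v →
    (left (I u) < left (I v)) × (left (I v) ≤ right (I u)) × (right (I u) < right (I v))
  crossLeft⇒intersect (p , q , r) =
    *-cancelˡ-< 2 _ _ p , *-cancelˡ-≤ 2 (≤-pred q) , *-cancelˡ-< 2 _ _ (≤-pred r)

  crossLeft⇒overlap : ∀ {u v} → CrossLeft u v → Overlap (I u) (I v)
  crossLeft⇒overlap {u} {v} cr =
    let p , q , r = crossLeft⇒intersect cr
    in (≤-trans (<⇒≤ p) (<⇒≤ (left<right (I v))) , q) ,
       (λ (_ , bv≤bu) → <⇒≱ r bv≤bu) , (λ (av≤au , _) → <⇒≱ p av≤au)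

  overlap-sym : ∀ {u v} → Overlap (I u) (I v) → Overlap (I v) (I u)
  overlap-sym ((p , q) , ¬c , ¬d) = (q , p) , ¬d , ¬c

  cross⇒overlap : ∀ {u v} → Cross u v → Overlap (I u) (I v)
  cross⇒overlap (inj₁ cr) = crossLeft⇒overlap cr
  cross⇒overlap {u} {v} (inj₂ cr) = overlap-sym {v} {u} (crossLeft⇒overlap cr)

  -- Comparing left ends decides which interval comes first. The two failed containments make the
  -- outer inequalities strict, and intersection gives the middle one.
  overlap⇒cross : ∀ {u v} → Overlap (I u) (I v) → Cross u v
  overlap⇒cross {u} {v} ((p , q) , ¬c , ¬d) with left (I u) ≤? left (I v)
  ... | yes l≤l =
    let r< = ≰⇒> λ r≤r → ¬c (l≤l , r≤r)
        l< = ≰⇒> λ l≥l → ¬d (l≥l , <⇒≤ r<)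
    in inj₁ (*-monoʳ-< 2 l< , s≤s (*-monoʳ-≤ 2 q) , s≤s (*-monoʳ-< 2 r<))
  ... | no l≰l =
    let l> = ≰⇒> l≰l
        r> = ≰⇒> λ r≤r → ¬d (<⇒≤ l> , r≤r)
    in inj₂ (*-monoʳ-< 2 l> , s≤s (*-monoʳ-≤ 2 p) , s≤s (*-monoʳ-< 2 r>))

  cf-colorable : ∀ t {k} → 4 ^ t * m < 5 ^ t → 3 * suc t ≤ k → CFColorableWith (OverlapGraph I) k
  cf-colorable t enough ≤k =
    let c , c-served = conflict-free t enough
    in (λ u → inject≤ (c u) ≤k) , λ v (u , v~u) →
       let w , v×w , unique = c-served v (u , overlap⇒cross v~u)
       in _ , w , cross⇒overlap v×w , refl ,
          λ x v~x eq → unique (overlap⇒cross v~x) (Fin.inject≤-injective ≤k ≤k _ _ eq)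

-- The binary tree

size : ℕ → ℕ
size zero = 1
size (suc h) = suc (size h + size h)

suc-size : ∀ h → suc (size h) ≡ 2 ^ suc h
suc-size zero = refl
suc-size (suc h) = begin
  suc (suc (size h + size h))      ≡⟨ cong suc (+-suc (size h) (size h)) ⟨
  suc (size h) + suc (size h)      ≡⟨ cong₂ _+_ (suc-size h) (trans (suc-size h) (sym (+-identityʳ _))) ⟩
  2 ^ suc (suc h)                  ∎
  where open ≡-Reasoning

module Tree (H : ℕ) where

  leaf : ℕ → Interval
  leaf o = ⟦ o , suc (size H + o) ⟧⟨ s≤s (m≤n+m o (size H)) ⟩

  -- The root of a subtree of height `h + 1`. Its closed interval spans the block of that subtree,
  -- whose last number is `o + (size h + size h)`.
  node : ℕ → ℕ → Interval
  node h o = ⟦ o , o + (size h + size h) ⟧⟨ m<m+n o (0<2size h) ⟩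
    where
    0<2size : ∀ h → 0 < size h + size h
    0<2size zero = z<s
    0<2size (suc h) = z<s

  -- Coordinates are preorder numbers: the block of the subtree at o is [o , o + size h).
  tree : ℕ → ℕ → List Interval
  tree zero o = leaf o ∷ []
  tree (suc h) o = node h o ∷ tree h (suc o) ++ tree h (suc o + size h)

  length-tree : ∀ h o → length (tree h o) ≡ size h
  length-tree zero o = refl
  length-tree (suc h) o = cong suc (trans (length-++ (tree h (suc o)))
    (cong₂ _+_ (length-tree h (suc o)) (length-tree h (suc o + size h))))

  block-end : ∀ h o → o + size (suc h) ≡ suc o + size h + size h
  block-end h o = trans (+-suc o _) (cong suc (sym (+-assoc o (size h) (size h))))

  left-block≤ : ∀ h o → suc o + size h ≤ o + size (suc h)
  left-block≤ h o = ≤-trans (m≤m+n _ (size h)) (≤-reflexive (sym (block-end h o)))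

  InBlock : ℕ → ℕ → ℕ → Set
  InBlock h o x = o ≤ x × x < o + size h

  -- Inner nodes end within their blocks, hence below `size H`, so in the forest the right end alone
  -- identifies the leaves.
  IsLeaf : Interval → Set
  IsLeaf K = size H < right K

  widen-left : ∀ h o {x} → InBlock h (suc o) x → InBlock (suc h) o x
  widen-left h o (p , q) = <⇒≤ p , <-≤-trans q (left-block≤ h o)

  widen-right : ∀ h o {x} → InBlock h (suc o + size h) x → InBlock (suc h) o x
  widen-right h o (p , q) =
    ≤-trans (≤-trans (n≤1+n o) (m≤m+n (suc o) (size h))) p ,
    <-≤-trans q (≤-reflexive (sym (block-end h o)))

  tree-bounds : ∀ h o {K} → K ∈ tree h o →
    InBlock h o (left K) × (right K < o + size h ⊎ IsLeaf K)
  tree-bounds zero o (here refl) =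
    (≤-refl , m<m+n o z<s) , inj₂ (s≤s (m≤m+n (size H) o))
  tree-bounds (suc h) o (here refl) =
    (≤-refl , m<m+n o z<s) , inj₁ (≤-reflexive (sym (+-suc o _)))
  tree-bounds (suc h) o (there K∈) with ∈-++⁻ (tree h (suc o)) K∈
  ... | inj₁ K∈ˡ with tree-bounds h (suc o) K∈ˡ
  ...   | bl , inj₁ r< = widen-left h o bl , inj₁ (<-≤-trans r< (left-block≤ h o))
  ...   | bl , inj₂ r> = widen-left h o bl , inj₂ r>
  tree-bounds (suc h) o (there K∈) | inj₂ K∈ʳ with tree-bounds h (suc o + size h) K∈ʳ
  ...   | bl , inj₁ r< = widen-right h o bl , inj₁ (<-≤-trans r< (≤-reflexive (sym (block-end h o))))
  ...   | bl , inj₂ r> = widen-right h o bl , inj₂ r>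

  -- Three ways not to overlap a node that spans `[o , e)`. Ancestors and leaves further left are
  -- both `around`; the `suc` lets an ancestor share the last number `e - 1` of the block.
  data Outside (o e : ℕ) (K : Interval) : Set where
    before : right K < o → Outside o e K
    after  : e ≤ left K → Outside o e K
    around : left K < o → e ≤ suc (right K) → Outside o e K

  outside-shrink : ∀ {o e o′ e′ K} → o ≤ o′ → e′ ≤ e → Outside o e K → Outside o′ e′ K
  outside-shrink o≤ e≤ (before p) = before (<-≤-trans p o≤)
  outside-shrink o≤ e≤ (after p) = after (≤-trans e≤ p)
  outside-shrink o≤ e≤ (around p q) = around (<-≤-trans p o≤) (≤-trans e≤ q)

  node-¬overlap-outside : ∀ {h o K} → Outside o (o + size (suc h)) K → ¬ Overlap (node h o) K
  node-¬overlap-outside (before p) ((q , _) , _) = <⇒≱ p q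
  node-¬overlap-outside {h} {o} (after p) ((_ , q) , _) =
    <⇒≱ (≤-trans (≤-reflexive (sym (+-suc o _))) p) q
  node-¬overlap-outside {h} {o} (around p q) (_ , _ , ¬c) =
    ¬c (<⇒≤ p , ≤-pred (≤-trans (≤-reflexive (sym (+-suc o _))) q))

  forest : List Interval
  forest = tree H 0

  -- The invariant for descending the tree: no interval from elsewhere overlaps an inner root of the
  -- subtree, and every leaf reaches past its block.
  record Subtree (h o : ℕ) : Set where
    field
      members : tree h o ⊆ forest
      others  : ∀ {K} → K ∈ forest → K ∈ tree h o ⊎ Outside o (o + size h) K
      bounded : o + size h ≤ size H
  open Subtree

  whole : Subtree H 0
  whole = record { members = λ K∈ → K∈ ; others = inj₁ ; bounded = ≤-refl }

  left-subtree : ∀ {h o} → Subtree (suc h) o → Subtree h (suc o)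
  left-subtree {h} {o} st = record
    { members = members st ∘ there ∘ ∈-++⁺ˡ
    ; others = λ K∈ → classify (others st K∈)
    ; bounded = ≤-trans (left-block≤ h o) (bounded st)
    }
    where
    classify : ∀ {K} → K ∈ tree (suc h) o ⊎ Outside o (o + size (suc h)) K →
      K ∈ tree h (suc o) ⊎ Outside (suc o) (suc o + size h) K
    classify (inj₂ out) = inj₂ (outside-shrink (n≤1+n o) (left-block≤ h o) out)
    classify (inj₁ (here refl)) =
      inj₂ (around ≤-refl (s≤s (+-monoʳ-≤ o (m≤m+n (size h) (size h)))))
    classify (inj₁ (there K∈)) with ∈-++⁻ (tree h (suc o)) K∈
    ... | inj₁ K∈ˡ = inj₁ K∈ˡ
    ... | inj₂ K∈ʳ = inj₂ (after (proj₁ (proj₁ (tree-bounds h _ K∈ʳ))))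

  -- Seen from the right block, inner nodes of the left block end before it, while leaves of the
  -- left block and the parent pass around it.
  right-subtree : ∀ {h o} → Subtree (suc h) o → Subtree h (suc o + size h)
  right-subtree {h} {o} st = record
    { members = members st ∘ there ∘ ∈-++⁺ʳ (tree h (suc o))
    ; others = λ K∈ → classify (others st K∈)
    ; bounded = end≤
    }
    where
    end≤ : suc o + size h + size h ≤ size H
    end≤ = ≤-trans (≤-reflexive (sym (block-end h o))) (bounded st)
    classify : ∀ {K} → K ∈ tree (suc h) o ⊎ Outside o (o + size (suc h)) K →
      K ∈ tree h (suc o + size h) ⊎ Outside (suc o + size h) (suc o + size h + size h) K
    classify (inj₂ out) = inj₂ (outside-shrink (≤-trans (n≤1+n o) (m≤m+n (suc o) (size h)))
                                               (≤-reflexive (sym (block-end h o))) out)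
    classify (inj₁ (here refl)) =
      inj₂ (around (m≤m+n (suc o) (size h)) (≤-reflexive (cong suc (+-assoc o (size h) (size h)))))
    classify (inj₁ (there K∈)) with ∈-++⁻ (tree h (suc o)) K∈
    ... | inj₂ K∈ʳ = inj₁ K∈ʳ
    ... | inj₁ K∈ˡ with tree-bounds h (suc o) K∈ˡ
    ...   | _ , inj₁ r< = inj₂ (before r<)
    ...   | (_ , l<) , inj₂ r> = inj₂ (around l< (≤-trans end≤ (≤-trans (<⇒≤ r>) (n≤1+n _))))

  LeafOf : ℕ → ℕ → Interval → Set
  LeafOf h o K = InBlock h o (left K) × IsLeaf K

  node-overlap⁺ : ∀ {h o} K → Subtree (suc h) o → o < left K → left K < o + size (suc h) →
    IsLeaf K → Overlap (node h o) K
  node-overlap⁺ {h} {o} K st o<l l< r> =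
    (≤-trans (<⇒≤ o<l) (<⇒≤ (left<right K)) , ≤-pred (≤-trans l< (≤-reflexive (+-suc o _)))) ,
    (λ (_ , r≤) → <⇒≱ (≤-<-trans (≤-trans (+-monoʳ-≤ o (n≤1+n _)) (bounded st)) r>) r≤) ,
    (λ (l≤ , _) → <⇒≱ o<l l≤)

  -- Intervals from elsewhere are `Outside`, and the node contains itself and all inner nodes below
  -- it. Only the leaves of its two halves remain.
  node-overlap⁻ : ∀ {h o K} → Subtree (suc h) o → K ∈ forest → Overlap (node h o) K →
    LeafOf h (suc o) K ⊎ LeafOf h (suc o + size h) K
  node-overlap⁻ {h} {o} st K∈ ov@(_ , ¬c , _) with others st K∈
  ... | inj₂ out = contradiction ov (node-¬overlap-outside {h} out)
  ... | inj₁ (here refl) = contradiction (≤-refl , ≤-refl) ¬c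
  ... | inj₁ (there K∈′) with ∈-++⁻ (tree h (suc o)) K∈′
  ...   | inj₁ K∈ˡ with tree-bounds h (suc o) K∈ˡ
  ...     | bl , inj₂ r> = inj₁ (bl , r>)
  ...     | (l≥ , _) , inj₁ r< = contradiction
    (<⇒≤ l≥ , ≤-pred (<-≤-trans r< (≤-trans (left-block≤ h o) (≤-reflexive (+-suc o _))))) ¬c
  node-overlap⁻ {h} {o} st K∈ ov@(_ , ¬c , _) | inj₁ (there K∈′) | inj₂ K∈ʳ
    with tree-bounds h (suc o + size h) K∈ʳ
  ...     | bl , inj₂ r> = inj₂ (bl , r>)
  ...     | (l≥ , _) , inj₁ r< = contradiction
    (≤-trans (≤-trans (n≤1+n o) (m≤m+n (suc o) (size h))) l≥ ,
     ≤-pred (<-≤-trans r< (≤-reflexive (cong suc (+-assoc o (size h) (size h)))))) ¬c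

  module _ {j : ℕ} (c : Fin (length forest) → Fin j)
           (cf : IsCFColoring (OverlapGraph (lookup forest)) c) where

    LeafColor : ℕ → ℕ → Fin j → Set
    LeafColor h o x = ∃ λ i → LeafOf h o (lookup forest i) × c i ≡ x

    -- The uniquely colored neighbor `u` of the root is a leaf of one half. Its color is new to the
    -- other half, whose `h + 1` colors it extends by one.
    leaf-colors : ∀ h {o} → Subtree h o →
      ∃ λ xs → Unique xs × length xs ≡ suc h × (∀ {x} → x ∈ xs → LeafColor h o x)
    leaf-colors zero {o} st = c i ∷ [] , [] ∷ [] , refl , λ { (here refl) → i , leaf-i , refl }
      where
      leaf∈ : leaf o ∈ forest
      leaf∈ = members st (here refl)
      i = index leaf∈
      leaf-i : LeafOf zero o (lookup forest i)
      leaf-i = subst (LeafOf zero o) (Any.lookup-index leaf∈)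
        ((≤-refl , m<m+n o z<s) , s≤s (m≤m+n (size H) o))
    leaf-colors (suc h) {o} st = extend (node-overlap⁻ st (∈-lookup {xs = forest} u)
        (subst (λ J → Overlap J (lookup forest u)) (sym v≡) v~u))
      where
      node∈ : node h o ∈ forest
      node∈ = members st (here refl)
      v = index node∈
      v≡ : node h o ≡ lookup forest v
      v≡ = Any.lookup-index node∈

      inˡ : ∀ K → LeafOf h (suc o) K → Overlap (node h o) K
      inˡ K ((p , q) , r) = node-overlap⁺ K st p (<-≤-trans q (left-block≤ h o)) r
      inʳ : ∀ K → LeafOf h (suc o + size h) K → Overlap (node h o) K
      inʳ K ((p , q) , r) = node-overlap⁺ K st (≤-trans (m≤m+n (suc o) (size h)) p)
        (<-≤-trans q (≤-reflexive (sym (block-end h o)))) r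

      IHˡ = leaf-colors h (left-subtree st)
      IHʳ = leaf-colors h (right-subtree st)

      overlaps : ∀ {i} → Overlap (node h o) (lookup forest i) → Overlap (lookup forest v) (lookup forest i)
      overlaps {i} = subst (λ J → Overlap J (lookup forest i)) v≡

      some-neighbor : ∃ λ i → Overlap (lookup forest v) (lookup forest i)
      some-neighbor with IHˡ
      -- The recursive list has length `h + 1`, so it has a first color; a leaf with that color
      -- overlaps the node.
      ... | _ ∷ _ , _ , _ , colors = let i , lf , _ = colors (here refl) in i , overlaps {i} (inˡ (lookup forest i) lf)

      witness = cf v some-neighbor
      u = proj₁ (proj₂ witness)
      v~u = proj₁ (proj₂ (proj₂ witness))

      unique : ∀ i → Overlap (node h o) (lookup forest i) → c i ≡ c u → i ≡ u
      unique i ov eq = proj₂ (proj₂ (proj₂ (proj₂ witness))) i (overlaps {i} ov)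
        (trans eq (proj₁ (proj₂ (proj₂ (proj₂ witness)))))

      widen : ∀ {o′} → (∀ {x} → InBlock h o′ x → InBlock (suc h) o x) →
        ∀ {x} → LeafColor h o′ x → LeafColor (suc h) o x
      widen w (i , (bl , lf) , eq) = i , (w bl , lf) , eq

      -- A leaf of the half at `o′` colored `c u` would be a neighbor of the root and thus equal to
      -- `u`, which is not in that half.
      cons : ∀ {o′ xs} → LeafOf (suc h) o (lookup forest u) →
        (∀ K → LeafOf h o′ K → Overlap (node h o) K) →
        ¬ LeafOf h o′ (lookup forest u) →
        (∀ {x} → InBlock h o′ x → InBlock (suc h) o x) →
        Unique xs → length xs ≡ suc h → (∀ {x} → x ∈ xs → LeafColor h o′ x) →
        ∃ λ xs → Unique xs × length xs ≡ suc (suc h) × (∀ {x} → x ∈ xs → LeafColor (suc h) o x)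
      cons {o′} {xs} leaf-u sees ¬leaf-u w uxs len colors =
        c u ∷ xs , All.tabulate fresh ∷ uxs , cong suc len ,
        λ { (here refl) → u , leaf-u , refl ; (there x∈) → widen w (colors x∈) }
        where
        fresh : ∀ {x} → x ∈ xs → c u ≢ x
        fresh x∈ refl =
          let i , lf , eq = colors x∈
          in ¬leaf-u (subst (λ i → LeafOf h o′ (lookup forest i)) (unique i (sees (lookup forest i) lf) eq) lf)

      extend : LeafOf h (suc o) (lookup forest u) ⊎ LeafOf h (suc o + size h) (lookup forest u) →
        ∃ λ xs → Unique xs × length xs ≡ suc (suc h) × (∀ {x} → x ∈ xs → LeafColor (suc h) o x)
      extend (inj₁ (bl , lf)) =
        let xs , uxs , len , colors = IHʳ
        in cons (widen-left h o bl , lf) inʳ (λ ((p , _) , _) → <⇒≱ (proj₂ bl) p)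
             (widen-right h o) uxs len colors
      extend (inj₂ (bl , lf)) =
        let xs , uxs , len , colors = IHˡ
        in cons (widen-right h o bl , lf) inˡ (λ ((_ , q) , _) → <⇒≱ q (proj₁ bl))
             (widen-left h o) uxs len colors

  cf-chromatic-forest : CFChromaticAtLeast (OverlapGraph (lookup forest)) (suc H)
  cf-chromatic-forest j (c , cf) =
    let xs , uxs , len , _ = leaf-colors c cf H whole
    in ≤-trans (≤-reflexive (sym len)) (unique-length≤ _≡_ uxs (λ {x} _ → x , refl) (λ _ _ p q → trans p (sym q)))

-- Logarithms and the constants

2^⌊log₂n⌋≤n : ∀ n → 1 ≤ n → 2 ^ ⌊log₂ n ⌋ ≤ n
2^⌊log₂n⌋≤n n = go ⌊log₂ n ⌋ n refl
  where
  go : ∀ k n → ⌊log₂ n ⌋ ≡ k → 1 ≤ n → 2 ^ k ≤ n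
  go zero n _ 1≤n = 1≤n
  go (suc k) (suc zero) () _
  go (suc k) n@(suc (suc n′)) eq _ = begin
    2 * 2 ^ k               ≤⟨ *-monoʳ-≤ 2 (go k ⌊ n /2⌋ (trans (⌊log₂⌊n/2⌋⌋≡⌊log₂n⌋∸1 n) (cong (_∸ 1) eq)) z<s) ⟩
    2 * ⌊ n /2⌋             ≡⟨ cong (⌊ n /2⌋ +_) (+-identityʳ _) ⟩
    ⌊ n /2⌋ + ⌊ n /2⌋       ≤⟨ +-monoʳ-≤ ⌊ n /2⌋ (⌊n/2⌋≤⌈n/2⌉ n) ⟩
    ⌊ n /2⌋ + ⌈ n /2⌉       ≡⟨ ⌊n/2⌋+⌈n/2⌉≡n n ⟩
    n                       ∎
    where open ≤-Reasoning

n<2^[1+⌊log₂n⌋] : ∀ n → n < 2 ^ suc ⌊log₂ n ⌋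
n<2^[1+⌊log₂n⌋] n = ≰⇒> λ 2^≤n → <⇒≱ (n<1+n ⌊log₂ n ⌋)
  (≤-trans (≤-reflexive (sym (⌊log₂[2^n]⌋≡n (suc ⌊log₂ n ⌋)))) (⌊log₂⌋-mono-≤ 2^≤n))

-- With `1 ≤ L`, `m` is below `2 ^ (L + 1) ≤ 4 ^ L`. The number 8 of rounds per unit of `L` comes
-- from `4 ^ 9 ≤ 5 ^ 8`, which is checked by evaluation.
enough-rounds : ∀ {m n} → 2 ≤ n → m ≤ n → 4 ^ (8 * ⌊log₂ n ⌋) * m < 5 ^ (8 * ⌊log₂ n ⌋)
enough-rounds {m} {n} 2≤n m≤n = begin-strict
  4 ^ (8 * L) * m        <⟨ *-monoʳ-< (4 ^ (8 * L)) {{m^n≢0 4 (8 * L)}} m<4^L ⟩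
  4 ^ (8 * L) * 4 ^ L    ≡⟨ *-comm (4 ^ (8 * L)) (4 ^ L) ⟩
  4 ^ L * 4 ^ (8 * L)    ≡⟨ ^-distribˡ-+-* 4 L (8 * L) ⟨
  4 ^ (9 * L)            ≡⟨ ^-*-assoc 4 9 L ⟨
  (4 ^ 9) ^ L            ≤⟨ ^-monoˡ-≤ L (from-yes (4 ^ 9 ≤? 5 ^ 8)) ⟩
  (5 ^ 8) ^ L            ≡⟨ ^-*-assoc 5 8 L ⟩
  5 ^ (8 * L)            ∎
  where
  open ≤-Reasoning
  L = ⌊log₂ n ⌋
  1≤L : 1 ≤ L
  1≤L = ⌊log₂⌋-mono-≤ 2≤n
  m<4^L : m < 4 ^ L
  m<4^L = begin-strict
    m                 ≤⟨ m≤n ⟩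
    n                 <⟨ n<2^[1+⌊log₂n⌋] n ⟩
    2 ^ suc L         ≤⟨ ^-monoʳ-≤ 2 (+-mono-≤ 1≤L (m≤m+n L 0)) ⟩
    2 ^ (2 * L)       ≡⟨ ^-*-assoc 2 2 L ⟨
    4 ^ L             ∎

theorem1 : Σ ℕ λ a → Σ ℕ λ b → Σ ℕ λ N → (n : ℕ) → N ≤ n →
    ((m : ℕ) → m ≤ n → (I : Fin m → Interval) →
    CFColorableWith (OverlapGraph I) (b * ⌊log₂ n ⌋))
    × (Σ ℕ λ m → m ≤ n × Σ (Fin m → Interval) λ I → Σ ℕ λ k →
    CFChromaticAtLeast (OverlapGraph I) k × ⌊log₂ n ⌋ ≤ a * k)
theorem1 = 1 , 27 , 2 , λ n 2≤n → upper n 2≤n , lower n 2≤n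
  where
  upper : ∀ n → 2 ≤ n → ∀ m → m ≤ n → (I : Fin m → Interval) →
    CFColorableWith (OverlapGraph I) (27 * ⌊log₂ n ⌋)
  upper n 2≤n m m≤n I =
    -- Three residues times `8 * L + 1` layer colors; `1 ≤ L` bounds the latter by `9 * L`, hence
    -- 27.
    IntervalChords.cf-colorable I (8 * L) (enough-rounds 2≤n m≤n) (begin
      3 * suc (8 * L)     ≤⟨ *-monoʳ-≤ 3 (+-monoˡ-≤ (8 * L) (⌊log₂⌋-mono-≤ 2≤n)) ⟩
      3 * (9 * L)         ≡⟨ *-assoc 3 9 L ⟨
      27 * L              ∎)
    where
    open ≤-Reasoning
    L = ⌊log₂ n ⌋

  lower : ∀ n → 2 ≤ n → Σ ℕ λ m → m ≤ n × Σ (Fin m → Interval) λ I → Σ ℕ λ k →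
    CFChromaticAtLeast (OverlapGraph I) k × ⌊log₂ n ⌋ ≤ 1 * k
  lower n 2≤n with ⌊log₂ n ⌋ | ⌊log₂⌋-mono-≤ 2≤n | 2^⌊log₂n⌋≤n n (<⇒≤ 2≤n)
  -- The tree of height `⌊log₂ n ⌋ - 1` has `2 ^ ⌊log₂ n ⌋ - 1` vertices and forces `⌊log₂ n ⌋`
  -- colors; `2 ≤ n` rules out logarithm zero.
  ... | suc h | _ | 2^L≤n =
    length forest ,
    ≤-trans (≤-reflexive (length-tree h 0)) (≤-trans (n≤1+n _) (≤-trans (≤-reflexive (suc-size h)) 2^L≤n)) ,
    lookup forest , suc h , cf-chromatic-forest , ≤-reflexive (sym (*-identityˡ (suc h)))
    where open Tree h
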